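{- (1) Let $H$ be a simple graph with finite vertex set $V$, and let $\varphi$ be a finite sequence of local complementation operations (on simple graphs) applicable to $H$. Then $H\varphi=\pi(i(H)+X*Y)$ for some $X,Y\subseteq V$ with $X\subseteq Y$ (in particular, $i(H)+X*Y$ is defined). (2) Conversely, let $G$ be a graph (loops allowed) with finite vertex set $V$. If $G+X*Y$ is defined for some $X,Y\subseteq V$, then there is a finite sequence $\varphi$ of local complementation operations (on simple graphs) applicable to $\pi(G)$ such that $\pi(G)\varphi=\pi(G+X*Y)$.
   Context: Graphs are finite, undirected, without parallel edges, loops allowed; a graph $G$ with vertex set $V$ is identified with its adjacency matrix, a symmetric $V\times V$-matrix over $\mathbb{F}_2$ whose diagonal entry at $u$ is $1$ iff $u$ has a loop. A simple graph is an undirected graph without loops or parallel edges. Operations are written postfix and associate to the left. For a simple graph $H$, $i(H)$ is $H$ regarded as a graph having no loops. For a graph $G$, $\pi(G)$ is the simple graph obtained from $G$ by removing all loops. Local complementation on a simple graph $H$ at any vertex $u$, denoted $H*\{u\}$, complements the edges in the neighbourhood of $u$: for distinct neighbours $v,w$ of $u$, $\{v,w\}$ is an edge of $H*\{u\}$ iff it is not an edge of $H$; all other edges are unchanged. It is applicable at every vertex. Operations on graphs with loops allowed: the loop complementation $G+X$ ($X\subseteq V$) adds $1$ to each diagonal entry of the adjacency matrix indexed by an element of $X$. The pivot $G*X$ is defined iff $\det G[X]=1$ over $\mathbb{F}_2$, where $G[X]$ is the principal submatrix on $X$ and $\det G[\varnothing]=1$; then, writing $G=\begin{pmatrix} P &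 Q \\ R & S \end{pmatrix}$ with $P=G[X]$, $$G*X=\begin{pmatrix} P^{ -1} & P^{ -1} Q \\ R P^{ -1} & S + R P^{ -1} Q \end{pmatrix}.$$ Thus $G+X*Y=(G+X)*Y$ is defined iff $\det (G+X)[Y]=1$. -}

module Defs where

open import Algebra.Bundles using (CommutativeRing)
open import Data.Bool.Base using (Bool; true; false; not; _∧_; _xor_)
open import Data.Bool.Properties using (xor-∧-commutativeRing; ∧-zeroʳ)
open import Data.Fin.Base using (Fin; zero; suc; punchIn)
open import Data.Fin.Properties using (_≟_)
open import Data.Fin.Subset using (Subset; inside; outside; ∣_∣; ∁)
open import Data.List.Base using (List; foldl)
open import Data.Nat.Base using (ℕ; zero; suc)
open import Data.Vec.Base using (_∷_; lookup)
open import Relation.Binary.PropositionalEquality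
  using (_≡_; refl; sym; cong; cong₂; trans)
open import Relation.Nullary.Decidable.Core using (does; yes; no)
open import Relation.Nullary.Negation.Core using (contradiction)

------------------------------------------------------------------------
-- Matrices over 𝔽₂: true is 1, false is 0, _xor_ is addition and _∧_ is
-- multiplication.

open import Algebra.Properties.Semiring.Sum
  (CommutativeRing.semiring xor-∧-commutativeRing) using (sum)

Matrix : ℕ → ℕ → Set
Matrix k l = Fin k → Fin l → Bool

infix 4 _≐_

_≐_ : ∀ {k l} → Matrix k l → Matrix k l → Set
A ≐ B = ∀ i j → A i j ≡ B i j

𝟙 : ∀ {k} → Matrix k k
𝟙 i j = does (i ≟ j)

infixl 6 _⊞_
infixl 7 _⊡_

_⊞_ : ∀ {k l} → Matrix k l → Matrix k l → Matrix k l
(A ⊞ B) i j = A i j xor B i j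

_⊡_ : ∀ {k l m} → Matrix k l → Matrix l m → Matrix k m
(A ⊡ B) i j = sum λ h → A i h ∧ B h j

-- Laplace expansion along the first row; since -1 = 1 in 𝔽₂, the
-- cofactors carry no signs.
det : ∀ {k} → Matrix k k → Bool
det {zero}  A = true
det {suc k} A =
  sum λ j → A zero j ∧ det (λ r c → A (suc r) (punchIn j c))

record IsInverse {k} (A B : Matrix k k) : Set where
  field
    inverseˡ : B ⊡ A ≐ 𝟙
    inverseʳ : A ⊡ B ≐ 𝟙

-- The elements of X in increasing order.
enum : ∀ {n} (X : Subset n) → Fin ∣ X ∣ → Fin n
enum (inside  ∷ X) zero    = zero
enum (inside  ∷ X) (suc i) = suc (enum X i)
enum (outside ∷ X) i       = suc (enum X i)

-- The block of A with rows in X and columns in Y.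
block : ∀ {n} → Matrix n n → (X Y : Subset n) → Matrix ∣ X ∣ ∣ Y ∣
block A X Y i j = A (enum X i) (enum Y j)

------------------------------------------------------------------------
-- Graphs on the vertex set Fin n

record Graph (n : ℕ) : Set where
  field
    adj       : Matrix n n
    symmetric : ∀ u v → adj u v ≡ adj v u

record SimpleGraph (n : ℕ) : Set where
  field
    adj         : Matrix n n
    symmetric   : ∀ u v → adj u v ≡ adj v u
    irreflexive : ∀ u → adj u u ≡ false

infix 4 _≈_

_≈_ : ∀ {n} → SimpleGraph n → SimpleGraph n → Set
H ≈ K = SimpleGraph.adj H ≐ SimpleGraph.adj K

𝟙-sym : ∀ {n} (u v : Fin n) → 𝟙 u v ≡ 𝟙 v u
𝟙-sym u v with u ≟ v | v ≟ u
... | yes _ | yes _ = refl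
... | no _  | no _  = refl
... | yes p | no ¬q = contradiction (sym p) ¬q
... | no ¬p | yes q = contradiction (sym q) ¬p

𝟙-refl : ∀ {n} (u : Fin n) → 𝟙 u u ≡ true
𝟙-refl u with u ≟ u
... | yes _ = refl
... | no ¬p = contradiction refl ¬p

i : ∀ {n} → SimpleGraph n → Graph n
i H = record { adj = adj ; symmetric = symmetric }
  where open SimpleGraph H

π : ∀ {n} → Graph n → SimpleGraph n
π G = record
  { adj         = λ u v → adj u v ∧ not (𝟙 u v)
  ; symmetric   = λ u v → cong₂ (λ a d → a ∧ not d) (symmetric u v) (𝟙-sym u v)
  ; irreflexive = λ u → trans (cong (λ d → adj u u ∧ not d) (𝟙-refl u))
                              (∧-zeroʳ (adj u u))
  }
  where open Graph G

------------------------------------------------------------------------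
-- Local complementation of simple graphs

infixl 5 _✶_ _✶✶_

_✶_ : ∀ {n} → SimpleGraph n → Fin n → SimpleGraph n
H ✶ u = record
  { adj         = λ v w → adj v w xor (adj u v ∧ adj u w ∧ not (𝟙 v w))
  ; symmetric   = λ v w → cong₂ _xor_ (symmetric v w) (flip-sym v w)
  ; irreflexive = λ v → cong₂ _xor_ (irreflexive v) (flip-irr v)
  }
  where
  open SimpleGraph H

  flip-sym : ∀ v w → adj u v ∧ adj u w ∧ not (𝟙 v w)
                   ≡ adj u w ∧ adj u v ∧ not (𝟙 w v)
  flip-sym v w rewrite 𝟙-sym v w with adj u v
  ... | true  = refl
  ... | false = sym (∧-zeroʳ (adj u w))

  flip-irr : ∀ v → adj u v ∧ adj u v ∧ not (𝟙 v v) ≡ false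
  flip-irr v rewrite 𝟙-refl v | ∧-zeroʳ (adj u v) = ∧-zeroʳ (adj u v)

-- Successive local complementation at the listed vertices, the head of
-- the list being applied first.
_✶✶_ : ∀ {n} → SimpleGraph n → List (Fin n) → SimpleGraph n
H ✶✶ φ = foldl _✶_ H φ

------------------------------------------------------------------------
-- Loop complementation and pivot of graphs

infixl 6 _+_

_+_ : ∀ {n} → Graph n → Subset n → Graph n
G + X = record
  { adj       = λ u v → adj u v xor (𝟙 u v ∧ lookup X u)
  ; symmetric = λ u v → cong₂ _xor_ (symmetric u v) (diag-sym u v)
  }
  where
  open Graph G

  diag-sym : ∀ u v → 𝟙 u v ∧ lookup X u ≡ 𝟙 v u ∧ lookup X v
  diag-sym u v with u ≟ v | v ≟ u
  ... | yes refl | yes _ = refl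
  ... | no _     | no _  = refl
  ... | yes p    | no ¬q = contradiction (sym p) ¬q
  ... | no ¬p    | yes q = contradiction (sym q) ¬p

-- The condition under which G * X is defined.
Pivotable : ∀ {n} → Graph n → Subset n → Set
Pivotable G X = det (block (Graph.adj G) X X) ≡ true

infix 4 _*_≔_

-- G * X ≔ G′ says that G * X is defined and that its value is G′.  The
-- fields determine G′, because inverses are unique and X and ∁ X cover
-- all vertices.
record _*_≔_ {n} (G : Graph n) (X : Subset n) (G′ : Graph n) : Set where
  P = block (Graph.adj G) X X
  Q = block (Graph.adj G) X (∁ X)
  R = block (Graph.adj G) (∁ X) X
  S = block (Graph.adj G) (∁ X) (∁ X)

  field
    defined   : Pivotable G X
    P⁻¹       : Matrix ∣ X ∣ ∣ X ∣
    isInverse : IsInverse P P⁻¹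
    block-XX  : block (Graph.adj G′) X X ≐ P⁻¹
    block-X∁  : block (Graph.adj G′) X (∁ X) ≐ P⁻¹ ⊡ Q
    block-∁X  : block (Graph.adj G′) (∁ X) X ≐ R ⊡ P⁻¹
    block-∁∁  : block (Graph.adj G′) (∁ X) (∁ X) ≐ S ⊞ R ⊡ P⁻¹ ⊡ Q

{-# OPTIONS --safe #-}
module Submission where

-- A graph G is encoded by its solution space { (x , y) : y = G x } in
-- (𝔽₂²)ⱽ.  Loop complementation, pivot and local complementation all act
-- on this space through invertible linear maps of 𝔽₂², one per vertex:
-- shears y ↦ y + x, swaps x ↔ y, and for local complementation at u the
-- shear x ↦ x + y at u together with y ↦ y + x at the neighbours of u.
-- Every invertible map of 𝔽₂² is a shear, or shear ∘ swap ∘ shear, so any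
-- composition becomes "add loops, swap on Y, add loops", where the first
-- loops can be chosen inside Y; the last ones are forgotten by π.
-- Conversely, G + X * Y being defined says that a choice of a line in
-- each 𝔽₂² is transversal to the solution space, and local
-- complementations turn these lines vertical one vertex at a time.

open import Defs
open import Algebra.Bundles using (CommutativeRing)
open import Data.Bool.Base using (Bool; true; false; not; _∧_; _xor_; if_then_else_)
open import Data.Bool.Properties
  using (xor-∧-commutativeRing; xor-assoc; xor-comm; xor-same; xor-identityʳ;
         ∧-assoc; ∧-comm; ∧-zeroʳ; ∧-identityʳ; ∧-distribˡ-xor; ∧-distribʳ-xor;
         ¬-not; not-involutive)
  renaming (_≟_ to _≟ᵇ_)
open import Data.Empty using (⊥-elim)
open import Data.Fin.Base using (Fin; zero; suc; punchIn; punchOut)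
open import Data.Fin.Permutation
  using (Permutation′; _⟨$⟩ʳ_; _⟨$⟩ˡ_; inverseʳ; transpose; remove; punchIn-permute)
open import Data.Fin.Properties
  using (_≟_; any?; punchInᵢ≢i; punchIn-punchOut; punchIn-injective)
open import Data.Fin.Subset
  using (Subset; _⊆_; _⊂_; _∈_; _∉_; _-_; ∁; inside; outside)
open import Data.Fin.Subset.Induction using (Acc; acc; ⊂-wellFounded)
open import Data.Fin.Subset.Properties using (_∈?_; x∈p⇒p-x⊂p; x∈p∧x≢y⇒x∈p-y)
open import Data.List.Base using (List; []; _∷_)
open import Data.Nat.Base using (ℕ; zero; suc)
open import Data.Product.Base using (_×_; _,_; proj₁; proj₂; swap; ∃-syntax)
open import Data.Product.Properties using (≡-dec)
open import Data.Vec.Base using (_∷_; []; lookup; tabulate)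
open import Data.Vec.Functional using () renaming (_∷_ to _∷ᶠ_)
open import Data.Vec.Properties using (lookup∘tabulate; []=⇒lookup; lookup⇒[]=)
open import Function.Base using (_∘_)
open import Relation.Binary.PropositionalEquality
open import Relation.Nullary.Decidable
  using (Dec; yes; no; map′; _×-dec_; from-yes; dec-true; dec-false)
open import Relation.Nullary.Negation using (contradiction)

open import Algebra.Properties.Semiring.Sum
  (CommutativeRing.semiring xor-∧-commutativeRing)
  using (sum; sum-cong-≗; sum-replicate-zero; sum-remove; ∑-distrib-+;
         sum-permute; *-distribˡ-sum)

open ≡-Reasoning

-- Sums over 𝔽₂

sum-zero : ∀ {k} {f : Fin k → Bool} → (∀ j → f j ≡ false) → sum f ≡ false
sum-zero {k} f≗0 = trans (sum-cong-≗ f≗0) (sum-replicate-zero k)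

sum-∧-zero : ∀ {k} (f : Fin k → Bool) {x : Fin k → Bool} →
  (∀ j → x j ≡ false) → sum (λ j → f j ∧ x j) ≡ false
sum-∧-zero f x≗0 = sum-zero λ j → trans (cong (f j ∧_) (x≗0 j)) (∧-zeroʳ (f j))

sum≡true⇒∃ : ∀ {k} (f : Fin k → Bool) → sum f ≡ true → ∃[ j ] f j ≡ true
sum≡true⇒∃ {suc k} f eq with f zero in f₀
... | true  = zero , f₀
... | false = let j , fj = sum≡true⇒∃ (f ∘ suc) eq in suc j , fj

sum-single : ∀ {k} (f : Fin k → Bool) p → (∀ j → j ≢ p → f j ≡ false) → sum f ≡ f p
sum-single {suc k} f p rest = begin
  sum f                             ≡⟨ sum-remove f ⟩
  f p xor sum (λ j → f (punchIn p j))
    ≡⟨ cong (f p xor_) (sum-zero λ j → rest _ (punchInᵢ≢i p j)) ⟩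
  f p xor false                     ≡⟨ xor-identityʳ (f p) ⟩
  f p                               ∎

-- In characteristic 2 the two equal terms cancel, and nothing else contributes.
sum-pair : ∀ {k} (f : Fin k → Bool) {p q} → p ≢ q → f p ≡ f q →
           (∀ j → j ≢ p → j ≢ q → f j ≡ false) → sum f ≡ false
sum-pair {suc k} f {p} {q} p≢q fp≡fq rest = begin
  sum f                                 ≡⟨ sum-remove f ⟩
  f p xor sum (λ j → f (punchIn p j))   ≡⟨ cong (f p xor_) (sum-single _ (punchOut p≢q) others) ⟩
  f p xor f (punchIn p (punchOut p≢q))  ≡⟨ cong (λ j → f p xor f j) (punchIn-punchOut p≢q) ⟩
  f p xor f q                           ≡⟨ cong (_xor f q) fp≡fq ⟩
  f q xor f q                           ≡⟨ xor-same (f q) ⟩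
  false                                 ∎
  where
  others : ∀ j → j ≢ punchOut p≢q → f (punchIn p j) ≡ false
  others j j≢ = rest _ (punchInᵢ≢i p j) λ eq →
    j≢ (punchIn-injective p _ _ (trans eq (sym (punchIn-punchOut p≢q))))

sum-∧-shift : ∀ {k} (a b x : Fin k → Bool) t →
  sum (λ c → (a c xor (b c ∧ t)) ∧ x c)
    ≡ sum (λ c → a c ∧ x c) xor (t ∧ sum (λ c → b c ∧ x c))
sum-∧-shift a b x t = begin
  sum (λ c → (a c xor (b c ∧ t)) ∧ x c)
    ≡⟨ sum-cong-≗ (λ c → expand (a c) (b c) (x c) t) ⟩
  sum (λ c → (a c ∧ x c) xor (t ∧ (b c ∧ x c)))
    ≡⟨ ∑-distrib-+ (λ c → a c ∧ x c) _ ⟩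
  sum (λ c → a c ∧ x c) xor sum (λ c → t ∧ (b c ∧ x c))
    ≡⟨ cong (sum (λ c → a c ∧ x c) xor_) (*-distribˡ-sum t (λ c → b c ∧ x c)) ⟨
  sum (λ c → a c ∧ x c) xor (t ∧ sum (λ c → b c ∧ x c)) ∎
  where
  expand : ∀ a b x t → (a xor (b ∧ t)) ∧ x ≡ (a ∧ x) xor (t ∧ (b ∧ x))
  expand a true  x true  = ∧-distribʳ-xor x a true
  expand a true  x false rewrite xor-identityʳ a | xor-identityʳ (a ∧ x) = refl
  expand a false x t     rewrite xor-identityʳ a | ∧-zeroʳ t | xor-identityʳ (a ∧ x) = refl

𝟙-≢ : ∀ {k} {u v : Fin k} → u ≢ v → 𝟙 u v ≡ false
𝟙-≢ {u = u} {v} = dec-false (u ≟ v)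

sum-𝟙ʳ : ∀ {k} (f : Fin k → Bool) p → sum (λ h → f h ∧ 𝟙 h p) ≡ f p
sum-𝟙ʳ f p = begin
  sum (λ h → f h ∧ 𝟙 h p)
    ≡⟨ sum-single _ p (λ h h≢p → trans (cong (f h ∧_) (𝟙-≢ h≢p)) (∧-zeroʳ (f h))) ⟩
  f p ∧ 𝟙 p p             ≡⟨ cong (f p ∧_) (𝟙-refl p) ⟩
  f p ∧ true              ≡⟨ ∧-identityʳ (f p) ⟩
  f p                     ∎

-- Determinants over 𝔽₂

minor : ∀ {k} → Matrix (suc k) (suc k) → Fin (suc k) → Matrix k k
minor A j r c = A (suc r) (punchIn j c)

cofactor : ∀ {k} → Matrix (suc k) (suc k) → Fin (suc k) → Bool
cofactor A j = A zero j ∧ det (minor A j)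

permuteColumns : ∀ {k} → Permutation′ k → Matrix k k → Matrix k k
permuteColumns σ A r c = A r (σ ⟨$⟩ʳ c)

det-cong : ∀ {k} {A B : Matrix k k} → A ≐ B → det A ≡ det B
det-cong {zero}  A≐B = refl
det-cong {suc k} A≐B = sum-cong-≗ λ j →
  cong₂ _∧_ (A≐B zero j) (det-cong λ r c → A≐B (suc r) (punchIn j c))

-- Without signs, a column permutation merely reindexes the Laplace expansion. The minor at `j` is
-- permuted in turn by `remove j σ`, hence the mutual induction.
det-permute : ∀ {k} (σ : Permutation′ k) A → det (permuteColumns σ A) ≡ det A
cofactor-permute : ∀ {k} (σ : Permutation′ (suc k)) A j →
  cofactor (permuteColumns σ A) j ≡ cofactor A (σ ⟨$⟩ʳ j)

det-permute {zero}  σ A = refl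
det-permute {suc k} σ A =
  trans (sum-cong-≗ (cofactor-permute σ A)) (sym (sum-permute (cofactor A) σ))

cofactor-permute σ A j = cong (A zero (σ ⟨$⟩ʳ j) ∧_) (trans
  (det-cong λ r c → cong (A (suc r)) (punchIn-permute σ j c))
  (det-permute (remove j σ) (minor A (σ ⟨$⟩ʳ j))))

-- In the expansion, the term at column `q` splits through its entry, since its minor omits column
-- `q`. Every other term splits through its minor by induction.
det-additive : ∀ {k} q {A B C : Matrix k k} →
  (∀ r → C r q ≡ A r q xor B r q) →
  (∀ r c → c ≢ q → C r c ≡ A r c) →
  (∀ r c → c ≢ q → C r c ≡ B r c) →
  det C ≡ det A xor det B
det-additive {suc k} q {A} {B} {C} C≡A+B C≡A C≡B =
  trans (sum-cong-≗ split) (∑-distrib-+ (cofactor A) (cofactor B))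
  where
  split : ∀ j → cofactor C j ≡ cofactor A j xor cofactor B j
  split j with j ≟ q
  ... | yes refl = begin
    C zero j ∧ dC                          ≡⟨ cong (_∧ dC) (C≡A+B zero) ⟩
    (A zero j xor B zero j) ∧ dC           ≡⟨ ∧-distribʳ-xor dC (A zero j) (B zero j) ⟩
    (A zero j ∧ dC) xor (B zero j ∧ dC)
      ≡⟨ cong₂ (λ a b → (A zero j ∧ a) xor (B zero j ∧ b))
               (det-cong λ r c → C≡A (suc r) _ (punchInᵢ≢i j c))
               (det-cong λ r c → C≡B (suc r) _ (punchInᵢ≢i j c)) ⟩
    cofactor A j xor cofactor B j          ∎
    where dC = det (minor C j)
  ... | no j≢q = begin
    C zero j ∧ det (minor C j)             ≡⟨ cong (C zero j ∧_) minors ⟩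
    C zero j ∧ (dA xor dB)                 ≡⟨ ∧-distribˡ-xor (C zero j) dA dB ⟩
    (C zero j ∧ dA) xor (C zero j ∧ dB)
      ≡⟨ cong₂ (λ a b → (a ∧ dA) xor (b ∧ dB)) (C≡A zero j j≢q) (C≡B zero j j≢q) ⟩
    cofactor A j xor cofactor B j          ∎
    where
    dA = det (minor A j)
    dB = det (minor B j)
    q′ = punchOut j≢q

    other : ∀ c → c ≢ q′ → punchIn j c ≢ q
    other c c≢q′ eq = c≢q′ (punchIn-injective j _ _ (trans eq (sym (punchIn-punchOut j≢q))))

    minors : det (minor C j) ≡ dA xor dB
    minors = det-additive q′
      (λ r → subst (λ x → C (suc r) x ≡ A (suc r) x xor B (suc r) x)
                   (sym (punchIn-punchOut j≢q)) (C≡A+B (suc r)))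
      (λ r c c≢ → C≡A (suc r) _ (other c c≢))
      (λ r c c≢ → C≡B (suc r) _ (other c c≢))

transpose-left : ∀ {k} (p q : Fin k) → transpose p q ⟨$⟩ʳ p ≡ q
transpose-left p q rewrite dec-true (p ≟ p) refl = refl

-- Transposing the equal columns fixes `A`, so the cofactors at `p` and `q` agree and cancel in
-- characteristic 2. All other minors still contain both columns.
det-alternating : ∀ {k} {p q} (A : Matrix k k) → p ≢ q →
  (∀ r → A r p ≡ A r q) → det A ≡ false
det-alternating {suc k} {p} {q} A p≢q Ap≡Aq = sum-pair (cofactor A) p≢q swapped others
  where
  τ = transpose p q

  invariant : permuteColumns τ A ≐ A
  invariant r c with c ≟ p
  ... | yes refl = sym (Ap≡Aq r)
  ... | no  _ with c ≟ q
  ...   | yes refl = Ap≡Aq r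
  ...   | no  _    = refl

  swapped : cofactor A p ≡ cofactor A q
  swapped = begin
    cofactor A p
      ≡⟨ cong₂ _∧_ (invariant zero p) (det-cong λ r c → invariant (suc r) (punchIn p c)) ⟨
    cofactor (permuteColumns τ A) p ≡⟨ cofactor-permute τ A p ⟩
    cofactor A (τ ⟨$⟩ʳ p)           ≡⟨ cong (cofactor A) (transpose-left p q) ⟩
    cofactor A q                    ∎

  others : ∀ j → j ≢ p → j ≢ q → cofactor A j ≡ false
  others j j≢p j≢q = trans (cong (A zero j ∧_) (det-alternating (minor A j) p′≢q′ eq)) (∧-zeroʳ _)
    where
    p′≢q′ : punchOut j≢p ≢ punchOut j≢q
    p′≢q′ e = p≢q (trans (sym (punchIn-punchOut j≢p))
                  (trans (cong (punchIn j) e) (punchIn-punchOut j≢q)))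

    eq : ∀ r → minor A j r (punchOut j≢p) ≡ minor A j r (punchOut j≢q)
    eq r rewrite punchIn-punchOut j≢p | punchIn-punchOut j≢q = Ap≡Aq (suc r)

-- A Boolean function on a finite set arises from zero by toggling single entries. Functions are
-- compared pointwise, so `P` has to respect `_≗_`.
toggle-induction : ∀ {k} (P : (Fin k → Bool) → Set) →
  (∀ {a b} → a ≗ b → P a → P b) → P (λ _ → false) →
  (∀ a c → P a → P (λ j → a j xor 𝟙 j c)) → ∀ a → P a
toggle-induction {zero}  P cong-P base step a = cong-P (λ ()) base
toggle-induction {suc k} P cong-P base step a = restore (a zero) refl
  where
  without-head : P (false ∷ᶠ (a ∘ suc))
  without-head = toggle-induction (λ t → P (false ∷ᶠ t))
    (λ a≗b → cong-P λ { zero → refl ; (suc j) → a≗b j })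
    (cong-P (λ { zero → refl ; (suc j) → refl }) base)
    (λ t c Pt → cong-P (λ { zero → refl ; (suc j) → refl }) (step _ (suc c) Pt))
    (a ∘ suc)

  restore : ∀ b → a zero ≡ b → P a
  restore false a₀ = cong-P (λ { zero → sym a₀ ; (suc j) → refl }) without-head
  restore true  a₀ = cong-P (λ { zero → sym a₀ ; (suc j) → xor-identityʳ _ })
                            (step _ zero without-head)

addFirstColumn : ∀ {k} → Matrix (suc k) (suc k) → (Fin k → Bool) → Matrix (suc k) (suc k)
addFirstColumn A a r zero    = A r zero
addFirstColumn A a r (suc c) = A r (suc c) xor (a c ∧ A r zero)

-- Toggling `a c` adds the first column once more to column `suc c`. By additivity the determinant
-- changes by that of a matrix with a repeated column, which is zero.
det-addFirstColumn : ∀ {k} (A : Matrix (suc k) (suc k)) a → det (addFirstColumn A a) ≡ det A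
det-addFirstColumn A = toggle-induction (λ a → det (addFirstColumn A a) ≡ det A) cong-P base step
  where
  cong-P : ∀ {a b} → a ≗ b → det (addFirstColumn A a) ≡ det A → det (addFirstColumn A b) ≡ det A
  cong-P {a} {b} a≗b = trans (det-cong {A = addFirstColumn A b} {addFirstColumn A a} λ where
    r zero    → refl
    r (suc c) → cong (λ t → A r (suc c) xor (t ∧ A r zero)) (sym (a≗b c)))

  base : det (addFirstColumn A (λ _ → false)) ≡ det A
  base = det-cong {A = addFirstColumn A (λ _ → false)} {A} λ where
    r zero    → refl
    r (suc c) → xor-identityʳ _

  step : ∀ a c → det (addFirstColumn A a) ≡ det A →
         det (addFirstColumn A (λ j → a j xor 𝟙 j c)) ≡ det A
  step a c eq = begin
    det (addFirstColumn A (λ j → a j xor 𝟙 j c))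
      ≡⟨ det-additive (suc c) {addFirstColumn A a} {B}
           (λ r → at-c (A r (suc c)) (a c) (A r zero) (𝟙-refl c) (𝟙-refl c))
           (λ r x → away r x)
           (λ r x x≢ → trans (away r x x≢) (sym (B-away r x x≢))) ⟩
    det (addFirstColumn A a) xor det B
      ≡⟨ cong₂ _xor_ eq (det-alternating {p = zero} {suc c} B (λ ()) λ r → sym (B-at r)) ⟩
    det A xor false
      ≡⟨ xor-identityʳ _ ⟩
    det A ∎
    where
    B : Matrix _ _
    B r x = if 𝟙 x (suc c) then A r zero else addFirstColumn A a r x

    B-at : ∀ r → B r (suc c) ≡ A r zero
    B-at r rewrite 𝟙-refl c = refl

    B-away : ∀ r x → x ≢ suc c → B r x ≡ addFirstColumn A a r x
    B-away r x x≢ rewrite 𝟙-≢ x≢ = refl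

    at-c : ∀ x a y {d e} → d ≡ true → e ≡ true →
           x xor ((a xor d) ∧ y) ≡ (x xor (a ∧ y)) xor (if e then y else (x xor (a ∧ y)))
    at-c x a y refl refl = begin
      x xor ((a xor true) ∧ y)   ≡⟨ cong (x xor_) (∧-distribʳ-xor y a true) ⟩
      x xor ((a ∧ y) xor y)      ≡⟨ xor-assoc x (a ∧ y) y ⟨
      (x xor (a ∧ y)) xor y      ∎

    away : ∀ r x → x ≢ suc c →
           addFirstColumn A (λ j → a j xor 𝟙 j c) r x ≡ addFirstColumn A a r x
    away r zero    _  = refl
    away r (suc x) x≢ rewrite 𝟙-≢ (x≢ ∘ cong suc) | xor-identityʳ (a x) = refl

-- Gaussian elimination by Schur complements

schur : ∀ {k} → Matrix (suc k) (suc k) → Matrix k k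
schur A r c = A (suc r) (suc c) xor (A zero (suc c) ∧ A (suc r) zero)

-- Adding multiples of the first column clears the rest of the first row. The one surviving minor is
-- then the Schur complement of the corner entry 1.
det-schur : ∀ {k} (A : Matrix (suc k) (suc k)) → A zero zero ≡ true → det A ≡ det (schur A)
det-schur A A₀₀ = begin
  det A                                                     ≡⟨ det-addFirstColumn A firstRow ⟨
  det A′                                                    ≡⟨⟩
  (A zero zero ∧ det (schur A)) xor sum (cofactor A′ ∘ suc)
    ≡⟨ cong₂ _xor_ (cong (_∧ det (schur A)) A₀₀) (sum-zero vanish) ⟩
  det (schur A) xor false                                   ≡⟨ xor-identityʳ _ ⟩
  det (schur A)                                             ∎
  where
  firstRow = A zero ∘ suc
  A′ = addFirstColumn A firstRow

  vanish : ∀ j → cofactor A′ (suc j) ≡ false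
  vanish j rewrite A₀₀ | ∧-identityʳ (A zero (suc j)) | xor-same (A zero (suc j)) = refl

-- This is the elimination of `x zero`: adding the suitable multiple of row `zero` to row `suc r`
-- cancels its first entry.
schur-row : ∀ {k} (A : Matrix (suc k) (suc k)) (x : Fin (suc k) → Bool) r →
  A zero zero ≡ true →
  sum (λ c → schur A r c ∧ x (suc c))
    ≡ sum (λ c → A (suc r) c ∧ x c) xor (A (suc r) zero ∧ sum (λ c → A zero c ∧ x c))
schur-row A x r A₀₀ = begin
  sum (λ c → schur A r c ∧ x (suc c))
    ≡⟨ sum-∧-shift (A (suc r) ∘ suc) (A zero ∘ suc) (x ∘ suc) t ⟩
  s xor (t ∧ s₀)
    ≡⟨ cancel t (x zero) s s₀ ⟩
  ((t ∧ x zero) xor s) xor (t ∧ (x zero xor s₀))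
    ≡⟨ cong (λ b → ((t ∧ x zero) xor s) xor (t ∧ ((b ∧ x zero) xor s₀))) A₀₀ ⟨
  sum (λ c → A (suc r) c ∧ x c) xor (t ∧ sum (λ c → A zero c ∧ x c)) ∎
  where
  t  = A (suc r) zero
  s  = sum (λ c → A (suc r) (suc c) ∧ x (suc c))
  s₀ = sum (λ c → A zero (suc c) ∧ x (suc c))

  cancel : ∀ t x s s₀ → s xor (t ∧ s₀) ≡ ((t ∧ x) xor s) xor (t ∧ (x xor s₀))
  cancel false x     s     s₀    = refl
  cancel true  false s     s₀    = refl
  cancel true  true  false false = refl
  cancel true  true  false true  = refl
  cancel true  true  true  false = refl
  cancel true  true  true  true  = refl

∧-trueˡ : ∀ {x y} → x ∧ y ≡ true → x ≡ true
∧-trueˡ {true} _ = refl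

module _ {k} (A : Matrix (suc k) (suc k)) (p : Fin (suc k)) where

  pivotFirst : Matrix (suc k) (suc k)
  pivotFirst = permuteColumns (transpose zero p) A

  det-pivotFirst : A zero p ≡ true → det (schur pivotFirst) ≡ det A
  det-pivotFirst A₀ₚ = trans (sym (det-schur pivotFirst A₀ₚ)) (det-permute (transpose zero p) A)

-- A nonzero term of the expansion provides a 1 in the first row, whose column is moved to the
-- front. By induction the Schur complement forces the tail of the permuted vector to vanish, and
-- the first row then forces its head to vanish.
det≡true⇒injective : ∀ {k} (A : Matrix k k) → det A ≡ true → (x : Fin k → Bool) →
  (∀ r → sum (λ c → A r c ∧ x c) ≡ false) → ∀ c → x c ≡ false
det≡true⇒injective {zero}  A detA x Ax≡0 ()
det≡true⇒injective {suc k} A detA x Ax≡0 = λ c →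
  trans (cong x (sym (inverseʳ τ {c}))) (x′≡0 (τ ⟨$⟩ˡ c))
  where
  pivot = sum≡true⇒∃ (cofactor A) detA
  p = proj₁ pivot
  A₀ₚ = ∧-trueˡ (proj₂ pivot)
  τ = transpose zero p
  A′ = pivotFirst A p
  x′ = x ∘ (τ ⟨$⟩ʳ_)

  A′x′≡0 : ∀ r → sum (λ c → A′ r c ∧ x′ c) ≡ false
  A′x′≡0 r = trans (sym (sum-permute (λ c → A r c ∧ x c) τ)) (Ax≡0 r)

  tail≡0 : ∀ c → x′ (suc c) ≡ false
  tail≡0 = det≡true⇒injective (schur A′) (trans (det-pivotFirst A p A₀ₚ) detA) (x′ ∘ suc) λ r →
    trans (schur-row A′ x′ r A₀ₚ)
      (trans (cong₂ (λ a b → a xor (A′ (suc r) zero ∧ b)) (A′x′≡0 (suc r)) (A′x′≡0 zero))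
             (∧-zeroʳ _))

  x′≡0 : ∀ c → x′ c ≡ false
  x′≡0 (suc c) = tail≡0 c
  x′≡0 zero    = begin
    x′ zero                             ≡⟨ xor-identityʳ _ ⟨
    x′ zero xor false
      ≡⟨ cong₂ _xor_ (cong (_∧ x′ zero) A₀ₚ) (sum-∧-zero (A′ zero ∘ suc) tail≡0) ⟨
    sum (λ c → A′ zero c ∧ x′ c)        ≡⟨ A′x′≡0 zero ⟩
    false                               ∎

-- Permuting the columns of `A` and the rows of `B` alike preserves the product. Once the corner is
-- 1, deleting the first row and column of the permuted `B` leaves a right inverse of the Schur
-- complement.
rightInverse⇒det≡true : ∀ {k} (A B : Matrix k k) → A ⊡ B ≐ 𝟙 → det A ≡ true
rightInverse⇒det≡true {zero}  A B AB≐𝟙 = refl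
rightInverse⇒det≡true {suc k} A B AB≐𝟙 =
  trans (sym (det-pivotFirst A p A₀ₚ))
        (rightInverse⇒det≡true (schur A′) (λ r c → B′ (suc r) (suc c)) λ r c →
          trans (schur-row A′ (λ h → B′ h (suc c)) r A₀ₚ)
            (trans (cong₂ (λ a b → a xor (A′ (suc r) zero ∧ b))
                          (A′B′≐𝟙 (suc r) (suc c)) (A′B′≐𝟙 zero (suc c)))
              (trans (cong (𝟙 r c xor_) (∧-zeroʳ _)) (xor-identityʳ _))))
  where
  -- The corner of the product is 1, so row `zero` of `A` cannot vanish.
  pivot = sum≡true⇒∃ (λ h → A zero h ∧ B h zero) (AB≐𝟙 zero zero)
  p = proj₁ pivot
  A₀ₚ = ∧-trueˡ (proj₂ pivot)
  τ = transpose zero p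
  A′ = pivotFirst A p

  B′ : Matrix _ _
  B′ r c = B (τ ⟨$⟩ʳ r) c

  A′B′≐𝟙 : A′ ⊡ B′ ≐ 𝟙
  A′B′≐𝟙 r c = trans (sym (sum-permute (λ h → A r h ∧ B h c) τ)) (AB≐𝟙 r c)

-- Solution spaces of adjacency matrices and their local transformations

State : ℕ → Set
State n = Fin n → Bool × Bool

infix 4 _solves_

_solves_ : ∀ {n} → State n → Matrix n n → Set
z solves A = ∀ v → proj₂ (z v) ≡ sum λ h → A v h ∧ proj₁ (z h)

solves-cong : ∀ {n} {A : Matrix n n} {z z′ : State n} → z ≗ z′ → z solves A → z′ solves A
solves-cong {A = A} z≗z′ z∈A v = trans (cong proj₂ (sym (z≗z′ v)))
  (trans (z∈A v) (sum-cong-≗ λ h → cong (λ p → A v h ∧ proj₁ p) (z≗z′ h)))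

LocalMap : ℕ → Set
LocalMap n = Fin n → Bool × Bool → Bool × Bool

Maps : ∀ {n} → LocalMap n → Matrix n n → Matrix n n → Set
Maps g A B = ∀ z → z solves A → (λ v → g v (z v)) solves B

shear : Bool → Bool × Bool → Bool × Bool
shear b (x , y) = x , y xor (b ∧ x)

swapIf : Bool → Bool × Bool → Bool × Bool
swapIf b p = if b then swap p else p

-- A relation rather than an operation, so that it covers both loop complementation and the
-- restoration of loops that `π` removed.
AddDiagonal : ∀ {n} → (Fin n → Bool) → Matrix n n → Matrix n n → Set
AddDiagonal d A B = ∀ u v → B u v ≡ A u v xor (𝟙 u v ∧ d u)

addDiagonal-sym : ∀ {n} {d} {A B : Matrix n n} → AddDiagonal d A B → AddDiagonal d B A
addDiagonal-sym {d = d} {A} {B} B≡ u v = sym (begin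
  B u v xor t            ≡⟨ cong (_xor t) (B≡ u v) ⟩
  (A u v xor t) xor t    ≡⟨ xor-assoc (A u v) t t ⟩
  A u v xor (t xor t)    ≡⟨ cong (A u v xor_) (xor-same t) ⟩
  A u v xor false        ≡⟨ xor-identityʳ _ ⟩
  A u v                  ∎)
  where t = 𝟙 u v ∧ d u

shear-maps : ∀ {n} {d} {A B : Matrix n n} → AddDiagonal d A B → Maps (shear ∘ d) A B
shear-maps {d = d} {A} {B} B≡ z z∈A v = sym (begin
  sum (λ h → B v h ∧ x h)
    ≡⟨ sum-cong-≗ (λ h → trans (cong (_∧ x h) (B≡ v h)) (expand (A v h) (x h) h)) ⟩
  sum (λ h → (A v h ∧ x h) xor ((d v ∧ x h) ∧ 𝟙 h v))
    ≡⟨ ∑-distrib-+ (λ h → A v h ∧ x h) _ ⟩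
  sum (λ h → A v h ∧ x h) xor sum (λ h → (d v ∧ x h) ∧ 𝟙 h v)
    ≡⟨ cong₂ _xor_ (sym (z∈A v)) (sum-𝟙ʳ (λ h → d v ∧ x h) v) ⟩
  proj₂ (z v) xor (d v ∧ x v) ∎)
  where
  x = proj₁ ∘ z

  expand : ∀ a x h → (a xor (𝟙 v h ∧ d v)) ∧ x ≡ (a ∧ x) xor ((d v ∧ x) ∧ 𝟙 h v)
  expand a x h = begin
    (a xor (𝟙 v h ∧ d v)) ∧ x           ≡⟨ ∧-distribʳ-xor x a _ ⟩
    (a ∧ x) xor ((𝟙 v h ∧ d v) ∧ x)     ≡⟨ cong ((a ∧ x) xor_) (∧-assoc (𝟙 v h) (d v) x) ⟩
    (a ∧ x) xor (𝟙 v h ∧ (d v ∧ x))     ≡⟨ cong ((a ∧ x) xor_) (∧-comm (𝟙 v h) _) ⟩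
    (a ∧ x) xor ((d v ∧ x) ∧ 𝟙 v h)     ≡⟨ cong (λ e → (a ∧ x) xor ((d v ∧ x) ∧ e)) (𝟙-sym v h) ⟩
    (a ∧ x) xor ((d v ∧ x) ∧ 𝟙 h v)     ∎

-- Blocks and pivots

sum-split : ∀ {n} (Y : Subset n) (f : Fin n → Bool) →
  sum f ≡ sum (f ∘ enum Y) xor sum (f ∘ enum (∁ Y))
sum-split []            f = refl
sum-split (inside  ∷ Y) f =
  trans (cong (f zero xor_) (sum-split Y (f ∘ suc))) (sym (xor-assoc (f zero) _ _))
sum-split (outside ∷ Y) f = begin
  f zero xor sum (f ∘ suc) ≡⟨ cong (f zero xor_) (sum-split Y (f ∘ suc)) ⟩
  f zero xor (a xor b)     ≡⟨ xor-assoc (f zero) a b ⟨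
  (f zero xor a) xor b     ≡⟨ cong (_xor b) (xor-comm (f zero) a) ⟩
  (a xor f zero) xor b     ≡⟨ xor-assoc a (f zero) b ⟩
  a xor (f zero xor b)     ∎
  where
  a = sum (f ∘ suc ∘ enum Y)
  b = sum (f ∘ suc ∘ enum (∁ Y))

lookup-enum : ∀ {n} (Y : Subset n) a → lookup Y (enum Y a) ≡ true
lookup-enum (inside  ∷ Y) zero    = refl
lookup-enum (inside  ∷ Y) (suc a) = lookup-enum Y a
lookup-enum (outside ∷ Y) a       = lookup-enum Y a

lookup-enum-∁ : ∀ {n} (Y : Subset n) a → lookup Y (enum (∁ Y) a) ≡ false
lookup-enum-∁ (inside  ∷ Y) a       = lookup-enum-∁ Y a
lookup-enum-∁ (outside ∷ Y) zero    = refl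
lookup-enum-∁ (outside ∷ Y) (suc a) = lookup-enum-∁ Y a

enum-surjective : ∀ {n} (Y : Subset n) v → lookup Y v ≡ true → ∃[ a ] enum Y a ≡ v
enum-surjective (inside  ∷ Y) zero    _   = zero , refl
enum-surjective (inside  ∷ Y) (suc v) v∈Y =
  let a , eq = enum-surjective Y v v∈Y in suc a , cong suc eq
enum-surjective (outside ∷ Y) (suc v) v∈Y =
  let a , eq = enum-surjective Y v v∈Y in a , cong suc eq

𝟙-enum : ∀ {n} (Y : Subset n) a b → 𝟙 (enum Y a) (enum Y b) ≡ 𝟙 a b
𝟙-enum (inside  ∷ Y) zero    zero    = refl
𝟙-enum (inside  ∷ Y) zero    (suc b) = refl
𝟙-enum (inside  ∷ Y) (suc a) zero    = refl
𝟙-enum (inside  ∷ Y) (suc a) (suc b) = 𝟙-enum Y a b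
𝟙-enum (outside ∷ Y) a       b       = 𝟙-enum Y a b

𝟙-enum-∁ : ∀ {n} (Y : Subset n) a b → 𝟙 (enum Y a) (enum (∁ Y) b) ≡ false
𝟙-enum-∁ Y a b = 𝟙-≢ λ eq → contradiction
  (trans (sym (lookup-enum Y a)) (trans (cong (lookup Y) eq) (lookup-enum-∁ Y b))) λ ()

-- Only one direction of the correspondence is needed: symmetry of both
-- matrices turns the right inverse into a two-sided one and supplies the
-- remaining blocks.
swap-maps⇒pivot : ∀ {n} (G G′ : Graph n) (Y : Subset n) →
  Maps (swapIf ∘ lookup Y) (Graph.adj G′) (Graph.adj G) → G * Y ≔ G′
swap-maps⇒pivot G G′ Y maps = record
  { defined   = rightInverse⇒det≡true P P′ PP′≐𝟙
  ; P⁻¹       = P′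
  ; isInverse = record { inverseˡ = P′P≐𝟙 ; inverseʳ = PP′≐𝟙 }
  ; block-XX  = λ a b → refl
  ; block-X∁  = λ a b → trans (G′.symmetric _ _) (trans (block-∁X b a)
                  (sum-cong-≗ λ h → ∧-flip (G.symmetric (enum (∁ Y) b) (enum Y h))
                                            (G′.symmetric (enum Y h) (enum Y a))))
  ; block-∁X  = block-∁X
  ; block-∁∁  = block-∁∁
  }
  where
  module G  = Graph G
  module G′ = Graph G′
  A  = G.adj
  A′ = G′.adj
  P  = block A Y Y
  P′ = block A′ Y Y

  ∧-flip : ∀ {a b c d} → a ≡ c → b ≡ d → a ∧ b ≡ d ∧ c
  ∧-flip {a} {b} refl refl = ∧-comm a b

  -- The solution of `A′` whose first coordinates form the unit vector at `w`. Applying `maps` to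
  -- these solutions yields all block identities.
  column : Fin _ → State _
  column w v = 𝟙 v w , A′ v w

  inY : Fin _ → Fin _ → Bool
  inY v w = sum λ a → A v (enum Y a) ∧ A′ (enum Y a) w

  off : Fin _ → Fin _ → Bool
  off v w = sum λ b → A v (enum (∁ Y) b) ∧ 𝟙 (enum (∁ Y) b) w

  swapped : ∀ v w → proj₂ (swapIf (lookup Y v) (column w v)) ≡ inY v w xor off v w
  swapped v w = begin
    proj₂ (swapIf (lookup Y v) (column w v))
      ≡⟨ maps (column w) (λ u → sym (sum-𝟙ʳ (A′ u) w)) v ⟩
    sum (λ h → A v h ∧ proj₁ (swapIf (lookup Y h) (column w h)))
      ≡⟨ sum-split Y _ ⟩
    _
      ≡⟨ cong₂ _xor_
           (sum-cong-≗ λ a → cong (entry (enum Y a)) (lookup-enum Y a))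
           (sum-cong-≗ λ b → cong (entry (enum (∁ Y) b)) (lookup-enum-∁ Y b)) ⟩
    inY v w xor off v w ∎
    where
    entry : Fin _ → Bool → Bool
    entry h t = A v h ∧ proj₁ (swapIf t (column w h))

  -- On `Y` the swap moves the unit vector into the second coordinate; outside `Y` the entry of `A′`
  -- stays there.
  row-Y : ∀ a w → 𝟙 (enum Y a) w ≡ inY (enum Y a) w xor off (enum Y a) w
  row-Y a w = trans (cong (λ t → proj₂ (swapIf t (column w v))) (sym (lookup-enum Y a)))
                    (swapped v w)
    where v = enum Y a

  row-∁ : ∀ a w → A′ (enum (∁ Y) a) w ≡ inY (enum (∁ Y) a) w xor off (enum (∁ Y) a) w
  row-∁ a w = trans (cong (λ t → proj₂ (swapIf t (column w v))) (sym (lookup-enum-∁ Y a)))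
                    (swapped v w)
    where v = enum (∁ Y) a

  off-Y : ∀ v b → off v (enum Y b) ≡ false
  off-Y v b = sum-∧-zero (A v ∘ enum (∁ Y)) λ c →
    trans (𝟙-sym (enum (∁ Y) c) (enum Y b)) (𝟙-enum-∁ Y b c)

  off-∁ : ∀ v b → off v (enum (∁ Y) b) ≡ A v (enum (∁ Y) b)
  off-∁ v b = trans (sum-cong-≗ λ c → cong (A v _ ∧_) (𝟙-enum (∁ Y) c b))
                    (sum-𝟙ʳ (λ c → A v (enum (∁ Y) c)) b)

  drop-off : ∀ {t} v b → t ≡ inY v (enum Y b) xor off v (enum Y b) → t ≡ inY v (enum Y b)
  drop-off v b eq = trans eq (trans (cong (inY v _ xor_) (off-Y v b)) (xor-identityʳ _))

  PP′≐𝟙 : P ⊡ P′ ≐ 𝟙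
  PP′≐𝟙 a b = trans (sym (drop-off _ b (row-Y a (enum Y b)))) (𝟙-enum Y a b)

  P′P≐𝟙 : P′ ⊡ P ≐ 𝟙
  P′P≐𝟙 a b = trans (sum-cong-≗ λ h → ∧-flip (G′.symmetric (enum Y a) (enum Y h))
                                            (G.symmetric (enum Y h) (enum Y b)))
                    (trans (PP′≐𝟙 b a) (𝟙-sym b a))

  block-∁X : block A′ (∁ Y) Y ≐ block A (∁ Y) Y ⊡ P′
  block-∁X a b = drop-off _ b (row-∁ a (enum Y b))

  block-∁∁ : block A′ (∁ Y) (∁ Y) ≐
             block A (∁ Y) (∁ Y) ⊞ block A (∁ Y) Y ⊡ P′ ⊡ block A Y (∁ Y)
  block-∁∁ a b = begin
    -- Passing to the transposed entry lets `block-∁X` be substituted, so that the sum appears with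
    -- the bracketing (R P⁻¹) Q.
    A′ va vb                              ≡⟨ G′.symmetric va vb ⟩
    A′ vb va                              ≡⟨ row-∁ b va ⟩
    inY vb va xor off vb va               ≡⟨ xor-comm (inY vb va) _ ⟩
    off vb va xor inY vb va
      ≡⟨ cong₂ _xor_ (trans (off-∁ vb a) (G.symmetric vb va))
                     (sum-cong-≗ λ h → trans (∧-flip (G.symmetric vb _) (G′.symmetric _ va))
                                             (cong (_∧ A _ vb) (block-∁X a h))) ⟩
    _ ∎
    where
    va = enum (∁ Y) a
    vb = enum (∁ Y) b

-- The action of local complementation on coordinates

-- Together with `from-yes`, this proves Boolean identities by evaluating their truth tables.
all? : {P : Bool → Set} → (∀ b → Dec (P b)) → Dec (∀ b → P b)
all? P? = map′ (λ { (t , f) true → t ; (t , f) false → f }) (λ f → f true , f false)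
               (P? true ×-dec P? false)

_≟²_ : (p q : Bool × Bool) → Dec (p ≡ q)
_≟²_ = ≡-dec _≟ᵇ_ _≟ᵇ_

-- The effect of a local complementation at one vertex: `tilt` at the complemented vertex,
-- `shearStep` at its neighbours, `keep` elsewhere.
data Step : Set where
  keep shearStep tilt : Step

apply : Step → Bool × Bool → Bool × Bool
apply keep      p       = p
apply shearStep p       = shear true p
apply tilt      (x , y) = x xor y , y

-- Normal forms for the group of invertible linear maps of 𝔽₂².
data Code : Set where
  straight : (z : Bool) → Code
  turned   : (d z : Bool) → Code

⟦_⟧ : Code → Bool × Bool → Bool × Bool
⟦ straight z ⟧ p = shear z p
⟦ turned d z ⟧ p = shear d (swap (shear z p))

infixr 6 _∙_ _∙ˡ_

_∙_ : Step → Code → Code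
keep      ∙ c              = c
shearStep ∙ straight z     = straight (not z)
shearStep ∙ turned d z     = turned (not d) z
tilt      ∙ straight z     = turned true (not z)
tilt      ∙ turned true  z = straight (not z)
tilt      ∙ turned false z = turned false (not z)

⟦∙⟧ : ∀ s c p → ⟦ s ∙ c ⟧ p ≡ apply s (⟦ c ⟧ p)
⟦∙⟧ keep      c              p       = refl
⟦∙⟧ shearStep (straight z)   (x , y) =
  from-yes (all? λ z → all? λ x → all? λ y →
    ⟦ shearStep ∙ straight z ⟧ (x , y) ≟² apply shearStep (⟦ straight z ⟧ (x , y))) z x y
⟦∙⟧ shearStep (turned d z)   (x , y) =
  from-yes (all? λ d → all? λ z → all? λ x → all? λ y →
    ⟦ shearStep ∙ turned d z ⟧ (x , y) ≟² apply shearStep (⟦ turned d z ⟧ (x , y))) d z x y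
⟦∙⟧ tilt      (straight z)   (x , y) =
  from-yes (all? λ z → all? λ x → all? λ y →
    ⟦ tilt ∙ straight z ⟧ (x , y) ≟² apply tilt (⟦ straight z ⟧ (x , y))) z x y
⟦∙⟧ tilt      (turned d z)   (x , y) =
  from-yes (all? λ d → all? λ z → all? λ x → all? λ y →
    ⟦ tilt ∙ turned d z ⟧ (x , y) ≟² apply tilt (⟦ turned d z ⟧ (x , y))) d z x y

-- The three lines through the origin of 𝔽₂²

data Line : Set where
  vertical : Line
  slope    : (d : Bool) → Line

-- The image of the vertical line under `⟦ c ⟧`.
line : Code → Line
line (straight z) = vertical
line (turned d z) = slope d

_on_ : Bool × Bool → Line → Set
(x , y) on vertical = x ≡ false
(x , y) on slope d  = y ≡ d ∧ x

_∙ˡ_ : Step → Line → Line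
keep      ∙ˡ l           = l
shearStep ∙ˡ vertical    = vertical
shearStep ∙ˡ slope d     = slope (not d)
tilt      ∙ˡ vertical    = slope true
tilt      ∙ˡ slope true  = vertical
tilt      ∙ˡ slope false = slope false

line-∙ : ∀ s c → line (s ∙ c) ≡ s ∙ˡ line c
line-∙ keep      c                = refl
line-∙ shearStep (straight z)     = refl
line-∙ shearStep (turned d z)     = refl
line-∙ tilt      (straight z)     = refl
line-∙ tilt      (turned true z)  = refl
line-∙ tilt      (turned false z) = refl

∙ˡ-involutive : ∀ s l → s ∙ˡ s ∙ˡ l ≡ l
∙ˡ-involutive keep      l             = refl
∙ˡ-involutive shearStep vertical      = refl
∙ˡ-involutive shearStep (slope d)     = cong slope (not-involutive d)
∙ˡ-involutive tilt      vertical      = refl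
∙ˡ-involutive tilt      (slope true)  = refl
∙ˡ-involutive tilt      (slope false) = refl

apply-on : ∀ s l p → p on l → apply s p on (s ∙ˡ l)
apply-on keep      l             p           p∈l  = p∈l
apply-on shearStep vertical      p           p∈l  = p∈l
apply-on shearStep (slope true)  (x , y)     refl = xor-same x
apply-on shearStep (slope false) (x , y)     refl = refl
apply-on tilt      vertical      (x , y)     refl = refl
apply-on tilt      (slope true)  (x , y)     refl = xor-same x
apply-on tilt      (slope false) (x , y)     refl = refl

apply-≡0 : ∀ s p → apply s p ≡ (false , false) → p ≡ (false , false)
apply-≡0 keep      p               eq = eq
apply-≡0 shearStep (false , false) eq = refl
apply-≡0 tilt      (false , false) eq = refl

slope? : ∀ l d → Dec (l ≡ slope d)
slope? vertical  d = no λ ()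
slope? (slope e) d = map′ (cong slope) (λ { refl → refl }) (e ≟ᵇ d)

no-slope⇒vertical : ∀ {l} → (∀ d → l ≢ slope d) → l ≡ vertical
no-slope⇒vertical {vertical} _    = refl
no-slope⇒vertical {slope d}  none = ⊥-elim (none d refl)

module _ {n} (H : SimpleGraph n) (u : Fin n) where
  open SimpleGraph H

  stepAt : Fin n → Step
  stepAt v = if 𝟙 u v then tilt else if adj u v then shearStep else keep

  stepAt-self : stepAt u ≡ tilt
  stepAt-self rewrite 𝟙-refl u = refl

  stepAt-vertical : ∀ {v} → v ≢ u → stepAt v ∙ˡ vertical ≡ vertical
  stepAt-vertical {v} v≢u rewrite 𝟙-≢ (v≢u ∘ sym) with adj u v
  ... | true  = refl
  ... | false = refl

  apply-stepAt : ∀ v x y →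
    (x xor (𝟙 u v ∧ y) , y xor (adj u v ∧ x)) ≡ apply (stepAt v) (x , y)
  apply-stepAt v x y with u ≟ v
  ... | yes refl rewrite irreflexive u | xor-identityʳ y = refl
  ... | no  _ with adj u v
  ...   | true  = cong (_, y xor x) (xor-identityʳ x)
  ...   | false = cong₂ _,_ (xor-identityʳ x) (xor-identityʳ y)

  -- With r = A x, a solution of `H ✶ u` satisfies y v = r v + a (r u + a x v), where a is the entry
  -- at u, v. Adding a x v leaves r v + a r u. As `u` has no loop, r u = y u, and this is exactly
  -- what replacing x u by x u + y u contributes.
  ✶-maps : Maps (apply ∘ stepAt) (SimpleGraph.adj (H ✶ u)) adj
  ✶-maps z z∈H✶u = solves-cong {A = adj} (λ v → apply-stepAt v (x v) (y v)) λ v → begin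
    y v xor (adj u v ∧ x v)
      ≡⟨ cong (_xor (adj u v ∧ x v)) (row v) ⟩
    (r v xor (adj u v ∧ (r u xor (adj u v ∧ x v)))) xor (adj u v ∧ x v)
      ≡⟨ cancel (adj u v) (r u) (x v) (r v) ⟩
    r v xor (adj u v ∧ r u)
      ≡⟨ cong₂ (λ a b → r v xor (a ∧ b)) (symmetric u v) (sym y-u) ⟩
    r v xor (adj v u ∧ y u)
      ≡⟨ cong (r v xor_) (sum-𝟙ʳ (λ h → adj v h ∧ y h) u) ⟨
    r v xor sum (λ h → (adj v h ∧ y h) ∧ 𝟙 h u)
      ≡⟨ ∑-distrib-+ (λ h → adj v h ∧ x h) _ ⟨
    sum (λ h → (adj v h ∧ x h) xor ((adj v h ∧ y h) ∧ 𝟙 h u))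
      ≡⟨ sum-cong-≗ (λ h → factor (adj v h) (x h) (y h) (𝟙-sym h u)) ⟩
    sum (λ h → adj v h ∧ (x h xor (𝟙 u h ∧ y h))) ∎
    where
    x = proj₁ ∘ z
    y = proj₂ ∘ z

    r : Fin n → Bool
    r v = sum λ h → adj v h ∧ x h

    factor : ∀ a x y {d e} → d ≡ e → (a ∧ x) xor ((a ∧ y) ∧ d) ≡ a ∧ (x xor (e ∧ y))
    factor a x y {d} refl = sym (begin
      a ∧ (x xor (d ∧ y))          ≡⟨ ∧-distribˡ-xor a x (d ∧ y) ⟩
      (a ∧ x) xor (a ∧ (d ∧ y))    ≡⟨ cong (λ t → (a ∧ x) xor (a ∧ t)) (∧-comm d y) ⟩
      (a ∧ x) xor (a ∧ (y ∧ d))    ≡⟨ cong ((a ∧ x) xor_) (∧-assoc a y d) ⟨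
      (a ∧ x) xor ((a ∧ y) ∧ d)    ∎)

    cancel : ∀ a s x r → (r xor (a ∧ (s xor (a ∧ x)))) xor (a ∧ x) ≡ r xor (a ∧ s)
    cancel a s x r = from-yes (all? λ a → all? λ s → all? λ x → all? λ r →
      (r xor (a ∧ (s xor (a ∧ x)))) xor (a ∧ x) ≟ᵇ r xor (a ∧ s)) a s x r

    expand : ∀ a b c x d {e} → d ≡ e → (a xor (b ∧ c ∧ not d)) ∧ x
           ≡ (a ∧ x) xor (b ∧ ((c ∧ x) xor ((c ∧ x) ∧ e)))
    expand a b c x d refl = from-yes
      (all? λ a → all? λ b → all? λ c → all? λ x → all? λ d →
        (a xor (b ∧ c ∧ not d)) ∧ x ≟ᵇ (a ∧ x) xor (b ∧ ((c ∧ x) xor ((c ∧ x) ∧ d))))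
      a b c x d

    row : ∀ v → y v ≡ r v xor (adj u v ∧ (r u xor (adj u v ∧ x v)))
    row v = begin
      y v
        ≡⟨ z∈H✶u v ⟩
      sum (λ h → (adj v h xor (adj u v ∧ adj u h ∧ not (𝟙 v h))) ∧ x h)
        ≡⟨ sum-cong-≗ (λ h → expand (adj v h) (adj u v) (adj u h) (x h) (𝟙 v h) (𝟙-sym v h)) ⟩
      sum (λ h → (adj v h ∧ x h) xor (adj u v ∧ f h))
        ≡⟨ ∑-distrib-+ (λ h → adj v h ∧ x h) _ ⟩
      r v xor sum (λ h → adj u v ∧ f h)
        ≡⟨ cong (r v xor_) (*-distribˡ-sum (adj u v) f) ⟨
      r v xor (adj u v ∧ sum f)
        ≡⟨ cong (λ t → r v xor (adj u v ∧ t)) (∑-distrib-+ (λ h → adj u h ∧ x h) _) ⟩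
      r v xor (adj u v ∧ (r u xor sum (λ h → (adj u h ∧ x h) ∧ 𝟙 h v)))
        ≡⟨ cong (λ t → r v xor (adj u v ∧ (r u xor t))) (sum-𝟙ʳ (λ h → adj u h ∧ x h) v) ⟩
      r v xor (adj u v ∧ (r u xor (adj u v ∧ x v))) ∎
      where
      f : Fin n → Bool
      f h = (adj u h ∧ x h) xor ((adj u h ∧ x h) ∧ 𝟙 h v)

    y-u : y u ≡ r u
    y-u = trans (row u)
      (trans (cong (λ a → r u xor (a ∧ (r u xor (adj u u ∧ x u)))) (irreflexive u))
             (xor-identityʳ (r u)))

-- Transversal lines and sequences of local complementations

Transversal : ∀ {n} → Matrix n n → (Fin n → Line) → Set
Transversal A ℓ = ∀ z → z solves A → (∀ v → z v on ℓ v) → ∀ v → z v ≡ (false , false)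

-- The map leads from the final graph back to `H`, so that prepending a complementation composes on
-- the left.
Reaches : ∀ {n} → SimpleGraph n → List (Fin n) → (Fin n → Code) → Set
Reaches H φ c = Maps (⟦_⟧ ∘ c) (SimpleGraph.adj (H ✶✶ φ)) (SimpleGraph.adj H)

reaches-[] : ∀ {n} (H : SimpleGraph n) → Reaches H [] (λ _ → straight false)
reaches-[] H z z∈H =
  solves-cong {A = SimpleGraph.adj H} (λ v → cong (proj₁ (z v) ,_) (sym (xor-identityʳ _))) z∈H

reaches-∷ : ∀ {n} (H : SimpleGraph n) u {φ c} → Reaches (H ✶ u) φ c →
  Reaches H (u ∷ φ) (λ v → stepAt H u v ∙ c v)
reaches-∷ H u {c = c} reaches z z∈ = solves-cong {A = SimpleGraph.adj H}
  (λ v → sym (⟦∙⟧ (stepAt H u v) (c v) (z v))) (✶-maps H u _ (reaches z z∈))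

reaches-some : ∀ {n} (H : SimpleGraph n) φ → ∃[ c ] Reaches H φ c
reaches-some H []      = (λ _ → straight false) , reaches-[] H
reaches-some H (u ∷ φ) =
  let c , reaches = reaches-some (H ✶ u) φ
  in  (λ v → stepAt H u v ∙ c v) , reaches-∷ H u {φ} {c} reaches

-- In the coordinates of the final graph the lines `ℓ` are all vertical.
ReachesLines : ∀ {n} → SimpleGraph n → (Fin n → Line) → Set
ReachesLines H ℓ = ∃[ φ ] ∃[ c ] (Reaches H φ c × (∀ v → line (c v) ≡ ℓ v))

module _ {n} (H : SimpleGraph n) (u : Fin n) {ℓ : Fin n → Line} where

  ℓ✶ : Fin n → Line
  ℓ✶ v = stepAt H u v ∙ˡ ℓ v

  -- A solution of `H ✶ u` on the moved lines is carried to a solution of `H` on `ℓ`, because each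
  -- step is an involution on lines. That image is zero, and steps are injective.
  transversal-✶ : Transversal (SimpleGraph.adj H) ℓ → Transversal (SimpleGraph.adj (H ✶ u)) ℓ✶
  transversal-✶ transversal z z∈ z-on v = apply-≡0 (stepAt H u v) (z v)
    (transversal _ (✶-maps H u z z∈) (λ w →
      subst (_ on_) (∙ˡ-involutive (stepAt H u w) (ℓ w))
            (apply-on (stepAt H u w) (ℓ✶ w) (z w) (z-on w))) v)

  reachesLines-✶ : ReachesLines (H ✶ u) ℓ✶ → ReachesLines H ℓ
  reachesLines-✶ (φ , c , reaches , lines) =
    u ∷ φ , _ , reaches-∷ H u {φ} {c} reaches , λ v → begin
      line (stepAt H u v ∙ c v)      ≡⟨ line-∙ (stepAt H u v) (c v) ⟩
      stepAt H u v ∙ˡ line (c v)     ≡⟨ cong (stepAt H u v ∙ˡ_) (lines v) ⟩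
      stepAt H u v ∙ˡ ℓ✶ v           ≡⟨ ∙ˡ-involutive (stepAt H u v) (ℓ v) ⟩
      ℓ v                            ∎

-- Otherwise the column of u would be a nonzero solution on the lines ℓ.
slope-neighbour : ∀ {n} (H : SimpleGraph n) {ℓ} → Transversal (SimpleGraph.adj H) ℓ →
  (∀ v → ℓ v ≢ slope true) → ∀ u → ℓ u ≡ slope false →
  ∃[ v ] (SimpleGraph.adj H u v ≡ true × ℓ v ≡ slope false)
slope-neighbour {n} H {ℓ} transversal none u ℓu
  with any? (λ v → (SimpleGraph.adj H u v ≟ᵇ true) ×-dec slope? (ℓ v) false)
... | yes found = found
... | no  alone = contradiction
  (trans (sym (𝟙-refl u)) (cong proj₁ (transversal column solution on-lines u))) λ ()
  where
  open SimpleGraph H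

  column : State n
  column v = 𝟙 v u , adj v u

  solution : column solves adj
  solution v = sym (sum-𝟙ʳ (adj v) u)

  on-line : ∀ v l → ℓ v ≡ l → column v on l
  on-line v vertical      ℓv = 𝟙-≢ {u = v} {u} λ { refl → contradiction (trans (sym ℓv) ℓu) λ () }
  on-line v (slope true)  ℓv = ⊥-elim (none v ℓv)
  on-line v (slope false) ℓv = ¬-not λ v~u → alone (v , trans (symmetric u v) v~u , ℓv)

  on-lines : ∀ v → column v on ℓ v
  on-lines v = on-line v (ℓ v) refl

-- Local complementation at a vertex of slope true makes that vertex
-- vertical; at a vertex of slope false it gives slope true to the
-- neighbours of slope false.
transversal⇒reachesLines : ∀ {n} (Y : Subset n) → Acc _⊂_ Y → ∀ H ℓ →
  (∀ v → v ∉ Y → ℓ v ≡ vertical) → Transversal (SimpleGraph.adj H) ℓ → ReachesLines H ℓ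
transversal⇒reachesLines Y (acc rec) H ℓ outside-Y transversal =
  search (any? (λ v → slope? (ℓ v) true)) (any? (λ v → slope? (ℓ v) false))
  where
  slope⇒∈ : ∀ {ℓ : Fin _ → Line} {u d} → (∀ v → v ∉ Y → ℓ v ≡ vertical) →
    ℓ u ≡ slope d → u ∈ Y
  slope⇒∈ {ℓ} {u} outside-Y ℓu with u ∈? Y
  ... | yes u∈Y = u∈Y
  ... | no  u∉Y = contradiction (trans (sym (outside-Y u u∉Y)) ℓu) λ ()

  straighten : ∀ H {ℓ u} → (∀ v → v ∉ Y → ℓ v ≡ vertical) →
    Transversal (SimpleGraph.adj H) ℓ → ℓ u ≡ slope true → ReachesLines H ℓ
  straighten H {ℓ} {u} outside-Y transversal ℓu = reachesLines-✶ H u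
    -- `Y` contains every vertex that is not vertical. As `u` becomes vertical, the induction
    -- continues with `Y - u`.
    (transversal⇒reachesLines (Y - u) (rec (x∈p⇒p-x⊂p (slope⇒∈ {ℓ} outside-Y ℓu)))
      (H ✶ u) (ℓ✶ H u) outside′ (transversal-✶ H u transversal))
    where
    outside′ : ∀ v → v ∉ Y - u → ℓ✶ H u {ℓ} v ≡ vertical
    outside′ v v∉ with v ≟ u
    ... | yes refl = trans (cong₂ _∙ˡ_ (stepAt-self H u) ℓu) refl
    ... | no  v≢u  = trans
      (cong (stepAt H u v ∙ˡ_) (outside-Y v λ v∈Y → v∉ (x∈p∧x≢y⇒x∈p-y v∈Y v≢u)))
      (stepAt-vertical H u v≢u)

  search : Dec (∃[ v ] ℓ v ≡ slope true) → Dec (∃[ v ] ℓ v ≡ slope false) → ReachesLines H ℓ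
  search (yes (u , ℓu)) _           = straighten H outside-Y transversal ℓu
  search (no none)      (no none′)  = [] , _ , reaches-[] H , λ v → sym (no-slope⇒vertical λ
    { true ℓv → none (v , ℓv) ; false ℓv → none′ (v , ℓv) })
  search (no none) (yes (u , ℓu)) with slope-neighbour H transversal (λ v ℓv → none (v , ℓv)) u ℓu
  ... | v , u~v , ℓv =
    -- The complementation at `u` keeps everything outside `Y` vertical and gives `v` slope true.
    -- The one at `v` then shrinks `Y`.
    reachesLines-✶ H u (straighten (H ✶ u) outside′ (transversal-✶ H u transversal) ℓ✶v)
    where
    u≢v : u ≢ v
    u≢v refl = contradiction (trans (sym u~v) (SimpleGraph.irreflexive H u)) λ ()

    ℓ✶v : ℓ✶ H u {ℓ} v ≡ slope true
    ℓ✶v rewrite 𝟙-≢ u≢v | u~v | ℓv = refl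

    outside′ : ∀ w → w ∉ Y → ℓ✶ H u {ℓ} w ≡ vertical
    outside′ w w∉Y = trans (cong (stepAt H u w ∙ˡ_) (outside-Y w w∉Y))
      (stepAt-vertical H u λ { refl → w∉Y (slope⇒∈ {ℓ} outside-Y ℓu) })

-- Pivots as sequences of local complementations

-- The line that removing the loop `d` and then swapping on `Y` make vertical.
lineOf : Bool → Bool → Line
lineOf turned? d = if turned? then slope d else vertical

-- The loop of the pivoted graph, chosen so that all shears around the swap cancel.
loopAfter : Bool → Code → Bool
loopAfter d (straight z) = d xor z
loopAfter d (turned _ z) = z

swapIf-normal : ∀ y d c p → line c ≡ lineOf y d →
  shear d (⟦ c ⟧ (shear (loopAfter d c) p)) ≡ swapIf y p
swapIf-normal false d (straight z) (x , y) refl =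
  from-yes (all? λ d → all? λ z → all? λ x → all? λ y →
    shear d (shear z (shear (d xor z) (x , y))) ≟² (x , y)) d z x y
swapIf-normal true d (turned .d z) (x , y) refl =
  from-yes (all? λ d → all? λ z → all? λ x → all? λ y →
    shear d (shear d (swap (shear z (shear z (x , y))))) ≟² (y , x)) d z x y

π-i+ : ∀ {n} (K : SimpleGraph n) Z → K ≈ π (i K + Z)
π-i+ K Z u v with u ≟ v
... | yes refl = trans (SimpleGraph.irreflexive K u) (sym (∧-zeroʳ _))
... | no  _    = sym (trans (∧-identityʳ _) (xor-identityʳ _))

-- Removing the loops `Z` from `i K + Z`, undoing `φ` and adding the loops `d` composes to the plain
-- swap on `Y`, which is a pivot.
reaches⇒pivot : ∀ {n} {H : SimpleGraph n} {φ c d} (G : Graph n) (Y : Subset n) →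
  AddDiagonal d (SimpleGraph.adj H) (Graph.adj G) → Reaches H φ c →
  (∀ v → line (c v) ≡ lineOf (lookup Y v) (d v)) →
  ∃[ G′ ] (G * Y ≔ G′ × H ✶✶ φ ≈ π G′)
reaches⇒pivot {H = H} {φ} {c} {d} G Y diagonal reaches lines =
  i K + Z , swap-maps⇒pivot G (i K + Z) Y maps , π-i+ K Z
  where
  K = H ✶✶ φ
  Z = tabulate λ v → loopAfter (d v) (c v)

  A+Z = Graph.adj (i K + Z)

  maps : Maps (swapIf ∘ lookup Y) A+Z (Graph.adj G)
  maps z z∈ = solves-cong {A = Graph.adj G} local (shear-maps diagonal _ (reaches _
    (shear-maps (addDiagonal-sym {A = SimpleGraph.adj K} {A+Z} λ u v → refl) z z∈)))
    where
    local : ∀ v → shear (d v) (⟦ c v ⟧ (shear (lookup Z v) (z v))) ≡ swapIf (lookup Y v) (z v)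
    local v rewrite lookup∘tabulate (λ v → loopAfter (d v) (c v)) v =
      swapIf-normal (lookup Y v) (d v) (c v) (z v) (lines v)

-- From local complementations to a pivot

sloped : Line → Bool
sloped vertical  = false
sloped (slope d) = true

slopeOf : Line → Bool
slopeOf vertical  = false
slopeOf (slope d) = d

lineOf-sloped : ∀ l → l ≡ lineOf (sloped l) (slopeOf l)
lineOf-sloped vertical  = refl
lineOf-sloped (slope d) = refl

slopeOf⇒sloped : ∀ l → slopeOf l ≡ true → sloped l ≡ true
slopeOf⇒sloped (slope d) _ = refl

localComplementations⇒pivot : ∀ {n} (H : SimpleGraph n) φ →
  ∃[ X ] ∃[ Y ] ∃[ G′ ] (X ⊆ Y × i H + X * Y ≔ G′ × H ✶✶ φ ≈ π G′)
localComplementations⇒pivot H φ =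
  let G′ , pivot , eq =
        reaches⇒pivot {H = H} {φ} {c} {lookup X} (i H + X) Y (λ u v → refl) reaches lines
  in  X , Y , G′ , X⊆Y , pivot , eq
  where
  c = proj₁ (reaches-some H φ)
  reaches = proj₂ (reaches-some H φ)
  -- The loops to add are the slopes of the lines. The default `false` at vertical lines is what
  -- puts `X` inside `Y`.
  X = tabulate (slopeOf ∘ line ∘ c)
  Y = tabulate (sloped ∘ line ∘ c)

  lines : ∀ v → line (c v) ≡ lineOf (lookup Y v) (lookup X v)
  lines v rewrite lookup∘tabulate (sloped ∘ line ∘ c) v | lookup∘tabulate (slopeOf ∘ line ∘ c) v =
    lineOf-sloped (line (c v))

  X⊆Y : X ⊆ Y
  X⊆Y {v} v∈X = lookup⇒[]= v Y (trans (lookup∘tabulate _ v)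
    (slopeOf⇒sloped (line (c v)) (trans (sym (lookup∘tabulate _ v)) ([]=⇒lookup v∈X))))

-- From a pivot to local complementations

loops : ∀ {n} → Graph n → Fin n → Bool
loops G v = Graph.adj G v v

addDiagonal-loops : ∀ {n} (G : Graph n) X →
  AddDiagonal (loops (G + X)) (SimpleGraph.adj (π G)) (Graph.adj (G + X))
addDiagonal-loops G X u v with u ≟ v
... | yes refl = trans (cong (λ t → Graph.adj G u u xor (t ∧ lookup X u)) (sym (𝟙-refl u)))
                       (cong (_xor loops (G + X) u) (sym (∧-zeroʳ (Graph.adj G u u))))
... | no  _    = cong (_xor false) (sym (∧-identityʳ (Graph.adj G u v)))

-- Outside `Y` the line forces x = 0; on `Y` it says that the row of the looped matrix annihilates
-- x. So x restricted to `Y` lies in the kernel of a nonsingular principal block; x vanishes, and y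
-- with it.
pivotable⇒transversal : ∀ {n} {A : Matrix n n} {d} (G : Graph n) (Y : Subset n) →
  AddDiagonal d A (Graph.adj G) → Pivotable G Y → Transversal A (λ v → lineOf (lookup Y v) (d v))
pivotable⇒transversal {A = A} {d} G Y diagonal pivotable z z∈A on-lines v =
  cong₂ _,_ (x≡0 v) (trans (z∈A v) (sum-∧-zero (A v) x≡0))
  where
  open Graph G
  x = proj₁ ∘ z

  x≡0-off : ∀ h → lookup Y h ≡ false → x h ≡ false
  x≡0-off h h∉Y = subst (λ t → z h on lineOf t (d h)) h∉Y (on-lines h)

  y≡dx : ∀ h → lookup Y h ≡ true → proj₂ (z h) ≡ d h ∧ x h
  y≡dx h h∈Y = subst (λ t → z h on lineOf t (d h)) h∈Y (on-lines h)

  kernel : ∀ r → sum (λ c → block adj Y Y r c ∧ x (enum Y c)) ≡ false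
  kernel r = begin
    s                                    ≡⟨ xor-identityʳ s ⟨
    s xor false                          ≡⟨ cong (s xor_) (sum-∧-zero (adj w ∘ enum (∁ Y)) λ c →
                                              x≡0-off _ (lookup-enum-∁ Y c)) ⟨
    s xor sum (λ c → adj w (enum (∁ Y) c) ∧ x (enum (∁ Y) c))
                                         ≡⟨ sum-split Y (λ h → adj w h ∧ x h) ⟨
    sum (λ h → adj w h ∧ x h)            ≡⟨ shear-maps {A = A} diagonal z z∈A w ⟨
    proj₂ (z w) xor (d w ∧ x w)          ≡⟨ cong (_xor (d w ∧ x w)) (y≡dx w (lookup-enum Y r)) ⟩
    (d w ∧ x w) xor (d w ∧ x w)          ≡⟨ xor-same (d w ∧ x w) ⟩
    false                                ∎
    where
    w = enum Y r
    s = sum (λ c → block adj Y Y r c ∧ x (enum Y c))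

  x≡0 : ∀ h → x h ≡ false
  x≡0 h with lookup Y h in h∈Y
  ... | false = x≡0-off h h∈Y
  ... | true  with enum-surjective Y h h∈Y
  ...   | a , refl = det≡true⇒injective (block adj Y Y) pivotable (x ∘ enum Y) kernel a

-- Definedness of the pivot makes the lines transversal, and the sequence that straightens them
-- realises this very pivot up to loops.
pivot⇒localComplementations : ∀ {n} (G : Graph n) X Y → Pivotable (G + X) Y →
  ∃[ G′ ] ((G + X * Y ≔ G′) × ∃[ φ ] (π G ✶✶ φ ≈ π G′))
pivot⇒localComplementations G X Y pivotable =
  let φ , c , reaches , lines = transversal⇒reachesLines Y (⊂-wellFounded Y) (π G) ℓ
        (λ v v∉Y → cong (λ t → lineOf t (loops (G + X) v)) (¬-not (v∉Y ∘ lookup⇒[]= v Y)))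
        (pivotable⇒transversal (G + X) Y (addDiagonal-loops G X) pivotable)
      G′ , pivot , eq =
        reaches⇒pivot {H = π G} {φ} {c} (G + X) Y (addDiagonal-loops G X) reaches lines
  in  G′ , pivot , φ , eq
  where
  ℓ : Fin _ → Line
  ℓ v = lineOf (lookup Y v) (loops (G + X) v)

theorem27 : (∀ (n : ℕ) (H : SimpleGraph n) (φ : List (Fin n)) →
    ∃[ X ] ∃[ Y ] ∃[ G′ ]
    (X ⊆ Y × i H + X * Y ≔ G′ × H ✶✶ φ ≈ π G′))
    ×
    (∀ (n : ℕ) (G : Graph n) (X Y : Subset n) → Pivotable (G + X) Y →
    ∃[ G′ ] ((G + X * Y ≔ G′) × ∃[ φ ] (π G ✶✶ φ ≈ π G′)))
theorem27 = (λ n → localComplementations⇒pivot) , (λ n → pivot⇒localComplementations)
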